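{- Let $X$ be a finite set and let $S$ be a partition of $X\times X$. Let $\gamma\colon X\otimes S\to X$ be the morphism of $\mathbf{Mat}_{\mathbb R_0^+}$ given by $\gamma_{xa}^y=1$ if $(x,y)\in a$ and $\gamma_{xa}^y=0$ otherwise. Then $\gamma$ is a module over some pointed magma $(S,\nabla,e)$ in $\mathbf{Mat}_{\mathbb R_0^+}$ if and only if $(X,S)$ satisfies both of the following conditions: (CC2) if $p\in S$ and $(x,x)\in p$ for some $x\in X$, then $p\subseteq \mathrm{id}_X=\{(z,z):z\in X\}$; (CC3) for all $a,b,c\in S$ and $(x,y)\in c$, the number of $z\in X$ such that $(x,z)\in a$ and $(z,y)\in b$ does not depend on the choice of $(x,y)\in c$. Moreover, $(S,\nabla,e)$ is then a monoid in $\mathbf{Mat}_{\mathbb R_0^+}$.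
   Context: $\mathbf{Mat}_{\mathbb R_0^+}$ is the category whose objects are finite sets and whose morphisms $f\colon X\to Y$ are matrices $(f_x^y)_{x\in X,y\in Y}$ of non-negative reals, with composition $(g\circ f)_a^c=\sum_{b}f_a^b g_b^c$. It is symmetric monoidal with $X\otimes Y=X\times Y$, $(f\otimes g)_{ac}^{bd}=f_a^b g_c^d$, unit object $I=\{*\}$, and associator, unitors $\lambda_A\colon I\otimes A\to A$, $\rho_A\colon A\otimes I\to A$ and symmetry transferred from the cartesian structure on finite sets (suppressed where evident); a map of finite sets is identified with its $0/1$ matrix. A pointed magma in $\mathbf{Mat}_{\mathbb R_0^+}$ is a triple $(S,\nabla,e)$ with $S$ a finite set, $\nabla\colon S\otimes S\to S$ and $e\colon I\to S$. It is a monoid if $\nabla\circ(e\otimes\mathrm{id}_S)=\lambda_S$, $\nabla\circ(\mathrm{id}_S\otimes e)=\rho_S$ and $\nabla\circ(\nabla\otimes\mathrm{id}_S)=\nabla\circ(\mathrm{id}_S\otimes\nabla)$. A module over a pointed magma $(S,\nabla,e)$ is a finite set $X$ with a morphism $\gamma\colon X\otimes S\to X$ such that $\gamma\circ(\gamma\otimes\mathrm{id}_S)=\gamma\circ(\mathrm{id}_X\otimes\nabla)$ and $\gamma\circ(\mathrm{id}_X\otimes e)=\rho_X$ (the canonical isomorphism $X\otimes I\to X$). -}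

module Defs where

open import Data.Bool.Base using (if_then_else_)
open import Data.Fin.Base using (Fin)
open import Data.Fin.Properties using (*↔×; 1↔⊤; inj⇒≟)
open import Data.Nat.Base as ℕ using (ℕ)
import Data.Nat.Properties as ℕ
open import Data.Product.Base using (Σ-syntax; ∃; _×_; _,_; proj₁; proj₂; assocʳ)
open import Data.Product using (∃!)
open import Data.Product.Function.NonDependent.Propositional using (_×-↔_)
open import Data.Rational.Base as ℚ using (ℚ; 0ℚ; 1ℚ; ½; ∣_∣; Positive; positive; nonNegative)
import Data.Rational.Properties as ℚ
open import Data.Rational.Solver using (module +-*-Solver)
open import Data.Sum.Base using (inj₁; inj₂)
open import Data.Unit.Base using (⊤)
open import Data.Vec.Base using (Vec; tabulate; count)
import Data.Vec.Functional as Vector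
open import Function.Base using (_on_; id)
open import Function.Bundles using (_↔_; module Inverse)
open import Function.Properties.Inverse using (↔-sym; ↔-trans; ↔⇒↣)
open import Level using (0ℓ)
open import Relation.Binary.Definitions using (DecidableEquality)
open import Relation.Binary.PropositionalEquality
  using (_≡_; refl; sym; trans; cong; cong₂; subst; subst₂)
open import Relation.Nullary using (Dec; yes; no; does)
open import Relation.Nullary.Decidable using (map′; _×-dec_)
open import Relation.Unary using (Pred; _∈_; _⊆_; Satisfiable)

Eventually : (ℕ → Set) → Set
Eventually P = Σ[ N ∈ ℕ ] (∀ n → N ℕ.≤ n → P n)

IsCauchy : (ℕ → ℚ) → Set
IsCauchy x = ∀ ε → 0ℚ ℚ.< ε →
  Σ[ N ∈ ℕ ] (∀ m n → N ℕ.≤ m → N ℕ.≤ n → ∣ x m ℚ.- x n ∣ ℚ.< ε)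

-- The Cauchy reals are used as a setoid: two sequences name the same real
-- number exactly when they are related by _≃_.
record ℝ : Set where
  no-eta-equality
  field
    seq    : ℕ → ℚ
    cauchy : IsCauchy seq

open ℝ public

infix 4 _≃_ _≤_

record _≃_ (x y : ℝ) : Set where
  constructor mk≃
  field
    close : ∀ ε → 0ℚ ℚ.< ε → Eventually λ n → ∣ seq x n ℚ.- seq y n ∣ ℚ.< ε

open _≃_ public

record _≤_ (x y : ℝ) : Set where
  constructor mk≤
  field
    almost : ∀ ε → 0ℚ ℚ.< ε → Eventually λ n → seq x n ℚ.< seq y n ℚ.+ ε

open _≤_ public

-- Only the existence of these moduli matters; left transparent, they would
-- be unfolded whenever two real numbers are compared.
abstract
  both : ∀ {P Q R : ℕ → Set} → (∀ n → P n → Q n → R n) →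
         Eventually P → Eventually Q → Eventually R
  both f (M , p) (N , q) = M ℕ.⊔ N , λ n h →
    f n (p n (ℕ.≤-trans (ℕ.m≤m⊔n M N) h)) (q n (ℕ.≤-trans (ℕ.m≤n⊔m M N) h))

  half>0 : ∀ {ε} → 0ℚ ℚ.< ε → 0ℚ ℚ.< ½ ℚ.* ε
  half>0 0<ε = ℚ.*-monoʳ-<-pos ½ 0<ε

  half+half : ∀ ε → ½ ℚ.* ε ℚ.+ ½ ℚ.* ε ≡ ε
  half+half ε = trans (sym (ℚ.*-distribʳ-+ ε ½ ½)) (ℚ.*-identityˡ ε)

  half+half< : ∀ {ε p q} → p ℚ.< ½ ℚ.* ε → q ℚ.< ½ ℚ.* ε → p ℚ.+ q ℚ.< ε
  half+half< {ε} p< q< = subst (_ ℚ.<_) (half+half ε) (ℚ.+-mono-< p< q<)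

  quotient : ∀ K → 0ℚ ℚ.< K → ∀ ε → 0ℚ ℚ.< ε → Σ[ δ ∈ ℚ ] 0ℚ ℚ.< δ × K ℚ.* δ ≡ ε
  quotient K 0<K ε 0<ε = 1/K ℚ.* ε , ℚ.positive⁻¹ _ {{ℚ.pos*pos⇒pos 1/K ε}} , K/K
    where
    instance
      K>0 : Positive K
      K>0 = positive 0<K
      ε>0 : Positive ε
      ε>0 = positive 0<ε
      K≢0 : ℚ.NonZero K
      K≢0 = ℚ.pos⇒nonZero K
    1/K : ℚ
    1/K = ℚ.1/ K
    instance
      1/K>0 : Positive 1/K
      1/K>0 = ℚ.1/pos⇒pos K
    K/K : K ℚ.* (1/K ℚ.* ε) ≡ ε
    K/K = trans (sym (ℚ.*-assoc K 1/K ε))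
            (trans (cong (ℚ._* ε) (ℚ.*-inverseʳ K)) (ℚ.*-identityˡ ε))

  triangle : ∀ p q {r} → p ℚ.+ q ≡ r → ∣ r ∣ ℚ.≤ ∣ p ∣ ℚ.+ ∣ q ∣
  triangle p q refl = ℚ.∣p+q∣≤∣p∣+∣q∣ p q

  bounded : ∀ x → IsCauchy x → Σ[ K ∈ ℚ ] 0ℚ ℚ.< K × Eventually λ n → ∣ x n ∣ ℚ.< K
  bounded x c with c 1ℚ (ℚ.positive⁻¹ 1ℚ)
  ... | N , h = 1ℚ ℚ.+ ∣ x N ∣
              , ℚ.+-mono-<-≤ (ℚ.positive⁻¹ 1ℚ) (ℚ.0≤∣p∣ (x N))
              , N , λ n N≤n → ℚ.≤-<-trans
                  (triangle (x n ℚ.- x N) (x N) (lemma (x n) (x N)))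
                  (ℚ.+-monoˡ-< ∣ x N ∣ (h n N N≤n ℕ.≤-refl))
    where
    open +-*-Solver
    lemma : ∀ p q → (p ℚ.- q) ℚ.+ q ≡ p
    lemma = solve 2 (λ p q → (p :- q) :+ q := p) refl

  constant-cauchy : ∀ q → IsCauchy (λ _ → q)
  constant-cauchy q ε 0<ε = 0 , λ _ _ _ _ →
    subst (ℚ._< ε) (sym (cong ∣_∣ (ℚ.+-inverseʳ q))) 0<ε

  +-cauchy : ∀ x y → IsCauchy x → IsCauchy y → IsCauchy (λ n → x n ℚ.+ y n)
  +-cauchy x y cx cy ε 0<ε with cx (½ ℚ.* ε) (half>0 0<ε) | cy (½ ℚ.* ε) (half>0 0<ε)
  ... | M , p | N , q = M ℕ.⊔ N , λ m n hm hn → ℚ.≤-<-trans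
    (triangle (x m ℚ.- x n) (y m ℚ.- y n) (rearrange (x m) (y m) (x n) (y n)))
    (half+half< (p m n (ℕ.≤-trans (ℕ.m≤m⊔n M N) hm) (ℕ.≤-trans (ℕ.m≤m⊔n M N) hn))
                (q m n (ℕ.≤-trans (ℕ.m≤n⊔m M N) hm) (ℕ.≤-trans (ℕ.m≤n⊔m M N) hn)))
    where
    open +-*-Solver
    rearrange : ∀ a b c d → (a ℚ.- c) ℚ.+ (b ℚ.- d) ≡ (a ℚ.+ b) ℚ.- (c ℚ.+ d)
    rearrange = solve 4 (λ a b c d → (a :- c) :+ (b :- d) := (a :+ b) :- (c :+ d)) refl

  product< : ∀ {p q K δ} → 0ℚ ℚ.< K → ∣ p ∣ ℚ.< K → ∣ q ∣ ℚ.< δ → ∣ p ℚ.* q ∣ ℚ.< K ℚ.* δ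
  product< {p} {q} {K} {δ} 0<K p<K q<δ = subst (ℚ._< K ℚ.* δ) (sym (ℚ.∣p*q∣≡∣p∣*∣q∣ p q))
    (ℚ.≤-<-trans
      (ℚ.*-monoʳ-≤-nonNeg ∣ q ∣ {{ℚ.∣-∣-nonNeg q}} (ℚ.<⇒≤ p<K))
      (ℚ.*-monoʳ-<-pos K {{positive 0<K}} q<δ))

  products-close : ∀ ε K δ L η a b c d → 0ℚ ℚ.< K → 0ℚ ℚ.< L →
                   K ℚ.* δ ≡ ½ ℚ.* ε → L ℚ.* η ≡ ½ ℚ.* ε →
                   ∣ a ∣ ℚ.< K → ∣ b ℚ.- d ∣ ℚ.< δ → ∣ d ∣ ℚ.< L → ∣ a ℚ.- c ∣ ℚ.< η →
                   ∣ a ℚ.* b ℚ.- c ℚ.* d ∣ ℚ.< ε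
  products-close ε K δ L η a b c d 0<K 0<L Kδ Lη a<K b-d<δ d<L a-c<η = ℚ.≤-<-trans
    (triangle (a ℚ.* (b ℚ.- d)) (d ℚ.* (a ℚ.- c)) (rearrange a b c d))
    (half+half<
      (subst (∣ a ℚ.* (b ℚ.- d) ∣ ℚ.<_) Kδ (product< {a} {b ℚ.- d} 0<K a<K b-d<δ))
      (subst (∣ d ℚ.* (a ℚ.- c) ∣ ℚ.<_) Lη (product< {d} {a ℚ.- c} 0<L d<L a-c<η)))
    where
    open +-*-Solver
    rearrange : ∀ a b c d → a ℚ.* (b ℚ.- d) ℚ.+ d ℚ.* (a ℚ.- c) ≡ a ℚ.* b ℚ.- c ℚ.* d
    rearrange = solve 4 (λ a b c d → a :* (b :- d) :+ d :* (a :- c) := a :* b :- c :* d) refl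

  *-cauchy : ∀ x y → IsCauchy x → IsCauchy y → IsCauchy (λ n → x n ℚ.* y n)
  *-cauchy x y cx cy ε 0<ε = go (bounded x cx) (bounded y cy)
    where
    go : (Σ[ K ∈ ℚ ] 0ℚ ℚ.< K × Eventually λ n → ∣ x n ∣ ℚ.< K) →
         (Σ[ L ∈ ℚ ] 0ℚ ℚ.< L × Eventually λ n → ∣ y n ∣ ℚ.< L) →
         Σ[ N ∈ ℕ ] (∀ m n → N ℕ.≤ m → N ℕ.≤ n → ∣ x m ℚ.* y m ℚ.- x n ℚ.* y n ∣ ℚ.< ε)
    go (K , 0<K , A , x<K) (L , 0<L , B , y<L) =
      let δ , 0<δ , Kδ = quotient K 0<K (½ ℚ.* ε) (half>0 0<ε)
          η , 0<η , Lη = quotient L 0<L (½ ℚ.* ε) (half>0 0<ε)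
          C , y-y<δ = cy δ 0<δ
          D , x-x<η = cx η 0<η
          AB = A ℕ.⊔ B
          CD = C ℕ.⊔ D
          ≤A : ∀ {k} → AB ℕ.⊔ CD ℕ.≤ k → A ℕ.≤ k
          ≤A = ℕ.≤-trans (ℕ.≤-trans (ℕ.m≤m⊔n A B) (ℕ.m≤m⊔n AB CD))
          ≤B : ∀ {k} → AB ℕ.⊔ CD ℕ.≤ k → B ℕ.≤ k
          ≤B = ℕ.≤-trans (ℕ.≤-trans (ℕ.m≤n⊔m A B) (ℕ.m≤m⊔n AB CD))
          ≤C : ∀ {k} → AB ℕ.⊔ CD ℕ.≤ k → C ℕ.≤ k
          ≤C = ℕ.≤-trans (ℕ.≤-trans (ℕ.m≤m⊔n C D) (ℕ.m≤n⊔m AB CD))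
          ≤D : ∀ {k} → AB ℕ.⊔ CD ℕ.≤ k → D ℕ.≤ k
          ≤D = ℕ.≤-trans (ℕ.≤-trans (ℕ.m≤n⊔m C D) (ℕ.m≤n⊔m AB CD))
      in AB ℕ.⊔ CD , λ m n hm hn →
        products-close ε K δ L η (x m) (y m) (x n) (y n) 0<K 0<L Kδ Lη
          (x<K m (≤A hm)) (y-y<δ m n (≤C hm) (≤C hn))
          (y<L n (≤B hn)) (x-x<η m n (≤D hm) (≤D hn))

constant : ℚ → ℝ
constant q = record { seq = λ _ → q ; cauchy = constant-cauchy q }

infixl 6 _+ᴿ_
infixl 7 _*ᴿ_

_+ᴿ_ : ℝ → ℝ → ℝ
x +ᴿ y = record
  { seq    = λ n → seq x n ℚ.+ seq y n
  ; cauchy = +-cauchy (seq x) (seq y) (cauchy x) (cauchy y)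
  }

_*ᴿ_ : ℝ → ℝ → ℝ
x *ᴿ y = record
  { seq    = λ n → seq x n ℚ.* seq y n
  ; cauchy = *-cauchy (seq x) (seq y) (cauchy x) (cauchy y)
  }

0ᴿ 1ᴿ : ℝ
0ᴿ = constant 0ℚ
1ᴿ = constant 1ℚ

abstract
  constant≥0 : ∀ {q} → 0ℚ ℚ.≤ q → 0ᴿ ≤ constant q
  constant≥0 0≤q = mk≤ λ ε 0<ε → 0 , λ _ _ → ℚ.+-mono-≤-< 0≤q 0<ε

  +-≥0 : ∀ {x y} → 0ᴿ ≤ x → 0ᴿ ≤ y → 0ᴿ ≤ x +ᴿ y
  +-≥0 {x} {y} 0≤x 0≤y = mk≤ λ ε 0<ε → both
    (λ n p q → subst (0ℚ ℚ.<_)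
       (trans (rearrange (seq x n) (seq y n) (½ ℚ.* ε)) (cong (seq x n ℚ.+ seq y n ℚ.+_) (half+half ε)))
       (ℚ.+-mono-< p q))
    (almost 0≤x (½ ℚ.* ε) (half>0 0<ε)) (almost 0≤y (½ ℚ.* ε) (half>0 0<ε))
    where
    open +-*-Solver
    rearrange : ∀ a b h → (a ℚ.+ h) ℚ.+ (b ℚ.+ h) ≡ (a ℚ.+ b) ℚ.+ (h ℚ.+ h)
    rearrange = solve 3 (λ a b h → (a :+ h) :+ (b :+ h) := (a :+ b) :+ (h :+ h)) refl

  product>- : ∀ {p q K δ} → 0ℚ ℚ.< δ → 0ℚ ℚ.≤ q → ∣ q ∣ ℚ.< K → 0ℚ ℚ.< p ℚ.+ δ →
              0ℚ ℚ.< p ℚ.* q ℚ.+ K ℚ.* δ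
  product>- {p} {q} {K} {δ} 0<δ 0≤q q<K 0<p+δ = ℚ.≤-<-trans
    (subst₂ ℚ._≤_ (ℚ.*-zeroˡ q) (ℚ.*-distribʳ-+ q p δ)
       (ℚ.*-monoʳ-≤-nonNeg q {{nonNegative 0≤q}} (ℚ.<⇒≤ 0<p+δ)))
    (ℚ.+-monoʳ-< (p ℚ.* q)
       (subst (ℚ._< K ℚ.* δ) (ℚ.*-comm q δ)
         (ℚ.*-monoˡ-<-pos δ {{positive 0<δ}} (subst (ℚ._< K) (ℚ.0≤p⇒∣p∣≡p 0≤q) q<K))))

  product-sign : ∀ ε K δ L η p q → 0ℚ ℚ.< ε → 0ℚ ℚ.< δ → 0ℚ ℚ.< η →
                 K ℚ.* δ ≡ ε → L ℚ.* η ≡ ε →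
                 ∣ p ∣ ℚ.< K → ∣ q ∣ ℚ.< L → 0ℚ ℚ.< p ℚ.+ η → 0ℚ ℚ.< q ℚ.+ δ →
                 0ℚ ℚ.< p ℚ.* q ℚ.+ ε
  product-sign ε K δ L η p q 0<ε 0<δ 0<η Kδ Lη p<K q<L 0<p+η 0<q+δ
    with ℚ.≤-total 0ℚ q | ℚ.≤-total 0ℚ p
  ... | inj₁ 0≤q | _        = subst (λ t → 0ℚ ℚ.< p ℚ.* q ℚ.+ t) Lη
    (product>- {p} {q} {L} {η} 0<η 0≤q q<L 0<p+η)
  ... | inj₂ _   | inj₁ 0≤p = subst₂ (λ s t → 0ℚ ℚ.< s ℚ.+ t) (ℚ.*-comm q p) Kδ
    (product>- {q} {p} {K} {δ} 0<δ 0≤p p<K 0<q+δ)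
  ... | inj₂ q≤0 | inj₂ p≤0 = ℚ.+-mono-≤-<
    (subst (ℚ._≤ p ℚ.* q) (ℚ.*-zeroˡ q)
      (ℚ.*-monoʳ-≤-nonPos q {{ℚ.nonPositive q≤0}} p≤0))
    0<ε

  *-≥0 : ∀ {x y} → 0ᴿ ≤ x → 0ᴿ ≤ y → 0ᴿ ≤ x *ᴿ y
  *-≥0 {x} {y} 0≤x 0≤y = mk≤ λ ε 0<ε →
    let K , 0<K , x<K = bounded (seq x) (cauchy x)
        L , 0<L , y<L = bounded (seq y) (cauchy y)
        δ , 0<δ , Kδ  = quotient K 0<K ε 0<ε
        η , 0<η , Lη  = quotient L 0<L ε 0<ε
    in both (λ n (x<K , 0<x+η) (y<L , 0<y+δ) →
         product-sign ε K δ L η (seq x n) (seq y n) 0<ε 0<δ 0<η Kδ Lη x<K y<L 0<x+η 0<y+δ)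
       (both (λ _ → _,_) x<K (almost 0≤x η 0<η))
       (both (λ _ → _,_) y<L (almost 0≤y δ 0<δ))

record ℝ≥0 : Set where
  field
    value  : ℝ
    nonneg : 0ᴿ ≤ value

open ℝ≥0 public

infix 4 _≈_
infixl 6 _+_
infixl 7 _*_

_≈_ : ℝ≥0 → ℝ≥0 → Set
_≈_ = _≃_ on value

_+_ _*_ : ℝ≥0 → ℝ≥0 → ℝ≥0
x + y = record { value = value x +ᴿ value y ; nonneg = +-≥0 (nonneg x) (nonneg y) }
x * y = record { value = value x *ᴿ value y ; nonneg = *-≥0 (nonneg x) (nonneg y) }

𝟘 𝟙 : ℝ≥0
𝟘 = record { value = 0ᴿ ; nonneg = constant≥0 {0ℚ} ℚ.≤-refl }
𝟙 = record { value = 1ᴿ ; nonneg = constant≥0 {1ℚ} (ℚ.<⇒≤ (ℚ.positive⁻¹ 1ℚ)) }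

indicator : ∀ {P : Set} → Dec P → ℝ≥0
indicator P? = if does P? then 𝟙 else 𝟘

record FinSet : Set₁ where
  no-eta-equality
  field
    Elem : Set
    size : ℕ
    enum : Fin size ↔ Elem

open FinSet public

private
  variable
    X Y Z W : FinSet

_≟_ : DecidableEquality (Elem X)
_≟_ {X} = inj⇒≟ (↔⇒↣ (↔-sym (enum X)))

elements : (X : FinSet) → Vec (Elem X) (size X)
elements X = tabulate (Inverse.to (enum X))

∑ : (X : FinSet) → (Elem X → ℝ≥0) → ℝ≥0
∑ X f = Vector.foldr _+_ 𝟘 (λ i → f (Inverse.to (enum X) i))

infixr 2 _⊗_

_⊗_ : FinSet → FinSet → FinSet
(X ⊗ Y) .Elem = Elem X × Elem Y
(X ⊗ Y) .size = size X ℕ.* size Y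
(X ⊗ Y) .enum = ↔-trans *↔× (enum X ×-↔ enum Y)

I : FinSet
I .Elem = ⊤
I .size = 1
I .enum = 1↔⊤

-- For f : Mat X Y, entry f x y is f_x^y: the domain is the lower index.
record Mat (X Y : FinSet) : Set where
  constructor mat
  field
    entry : Elem X → Elem Y → ℝ≥0

open Mat public

infix 4 _≋_

_≋_ : Mat X Y → Mat X Y → Set
f ≋ g = ∀ x y → entry f x y ≈ entry g x y

infixr 9 _∘ₘ_

_∘ₘ_ : Mat Y Z → Mat X Y → Mat X Z
_∘ₘ_ {Y = Y} g f = mat λ a c → ∑ Y λ b → entry f a b * entry g b c

infixr 10 _⊗ₘ_

_⊗ₘ_ : Mat X Y → Mat Z W → Mat (X ⊗ Z) (Y ⊗ W)
f ⊗ₘ g = mat λ (a , c) (b , d) → entry f a b * entry g c d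

fromMap : (Elem X → Elem Y) → Mat X Y
fromMap {Y = Y} f = mat λ x y → indicator (_≟_ {Y} (f x) y)

idₘ : (X : FinSet) → Mat X X
idₘ X = fromMap id

α : (X Y Z : FinSet) → Mat ((X ⊗ Y) ⊗ Z) (X ⊗ (Y ⊗ Z))
α X Y Z = fromMap assocʳ

λₘ : (X : FinSet) → Mat (I ⊗ X) X
λₘ X = fromMap proj₂

ρₘ : (X : FinSet) → Mat (X ⊗ I) X
ρₘ X = fromMap proj₁

record PointedMagma (S : FinSet) : Set where
  field
    ∇ : Mat (S ⊗ S) S
    e : Mat I S

record IsMonoid {S : FinSet} (M : PointedMagma S) : Set where
  open PointedMagma M
  field
    identityˡ : ∇ ∘ₘ (e ⊗ₘ idₘ S) ≋ λₘ S
    identityʳ : ∇ ∘ₘ (idₘ S ⊗ₘ e) ≋ ρₘ S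
    assoc     : ∇ ∘ₘ (∇ ⊗ₘ idₘ S) ≋ ∇ ∘ₘ (idₘ S ⊗ₘ ∇) ∘ₘ α S S S

record IsModule {S : FinSet} (M : PointedMagma S) {X : FinSet} (γ : Mat (X ⊗ S) X) : Set where
  open PointedMagma M
  field
    action : γ ∘ₘ (γ ⊗ₘ idₘ S) ≋ γ ∘ₘ (idₘ X ⊗ₘ ∇) ∘ₘ α X S S
    unit   : γ ∘ₘ (idₘ X ⊗ₘ e) ≋ ρₘ X

-- A partition is a set of subsets of A, here indexed by the finite set Blocks.
-- The index of a block is determined by the block as a subset, because blocks
-- are nonempty and each element lies in only one. Membership need not be
-- assumed decidable: to decide p ∈ block a, compare a with the block of p.
record Partition (A : FinSet) : Set₁ where
  field
    Blocks   : FinSet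
    block    : Elem Blocks → Pred (Elem A) 0ℓ
    nonempty : ∀ a → Satisfiable (block a)
    unique   : ∀ p → ∃! _≡_ λ a → p ∈ block a

  _∈?_ : ∀ p a → Dec (p ∈ block a)
  p ∈? a with unique p
  ... | b , p∈b , b-unique = map′ (λ b≡a → subst (λ c → p ∈ block c) b≡a p∈b) b-unique
                                  (_≟_ {Blocks} b a)

module _ {X : FinSet} (S : Partition (X ⊗ X)) where
  open Partition S

  canonicalAction : Mat (X ⊗ Blocks) X
  canonicalAction = mat λ (x , a) y → indicator ((x , y) ∈? a)

  Diagonal : Pred (Elem X × Elem X) 0ℓ
  Diagonal (x , y) = x ≡ y

  CC2 : Set
  CC2 = ∀ p → (∃ λ x → (x , x) ∈ block p) → block p ⊆ Diagonal

  intermediates : (a b : Elem Blocks) (x y : Elem X) → ℕ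
  intermediates a b x y = count (λ z → ((x , z) ∈? a) ×-dec ((z , y) ∈? b)) (elements X)

  CC3 : Set
  CC3 = ∀ a b c {x y x′ y′} → (x , y) ∈ block c → (x′ , y′) ∈ block c →
        intermediates a b x y ≡ intermediates a b x′ y′

-- Let c(x,y) be the block of (x,y).  Since γ_{xd}^y = [c(x,y) = d], contracting
-- any vector f indexed by the blocks with γ gives f^{c(x,y)}.  The two module
-- axioms therefore say exactly that
--   ∇_{ab}^{c(x,y)} = #{z : (x,z) ∈ a, (z,y) ∈ b}  and  e^{c(x,y)} = [x = y].
-- So ∇ and e exist precisely when the right-hand sides depend only on c(x,y),
-- which is CC3 and CC2.  As every block is inhabited, the induced action on
-- matrices is faithful, so the monoid laws are inherited from the unit and
-- associative laws of matrix multiplication.  The only property of ℝ≥0 used,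
-- beyond being a commutative semiring, is that the numbers 1 + ⋯ + 1 are distinct.
module Submission where

open import Algebra.Bundles using (CommutativeSemiring)
import Algebra.Properties.CommutativeSemigroup as CommutativeSemigroupProperties
import Algebra.Properties.Monoid.Mult as Multiples
import Algebra.Properties.Semiring.Sum as SemiringSum
open import Algebra.Structures.Biased using (isCommutativeSemiringˡ)
open import Data.Bool.Base using (true; false; if_then_else_)
open import Data.Fin.Base using (Fin; zero; suc; _↑ˡ_; _↑ʳ_; combine)
open import Data.Fin.Properties using (0≢1+n; suc-injective; remQuot-combine)
open import Data.Nat.Base as ℕ using (ℕ; zero; suc)
import Data.Nat.Properties as ℕ
open import Data.Product using (∃; _×_; _,_; proj₁; proj₂; uncurry; assocʳ)
open import Data.Rational.Base as ℚ using (ℚ; 0ℚ; 1ℚ; ½; ∣_∣)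
import Data.Rational.Properties as ℚ
open import Data.Rational.Solver using (module +-*-Solver)
open import Data.Sum.Base using (inj₁; inj₂)
open import Data.Unit.Base using (tt)
open import Data.Vec.Base using (count; tabulate)
open import Function.Base using (_∘_; id)
open import Function.Bundles using (_⇔_; mk⇔; module Inverse)
open import Level using (0ℓ)
open import Relation.Binary.PropositionalEquality as ≡ using (_≡_; _≢_)
import Relation.Binary.Reasoning.Setoid as SetoidReasoning
open import Relation.Binary.Structures using (IsEquivalence)
open import Relation.Nullary using (Dec; yes; no; does; ¬_; contradiction)
open import Relation.Nullary.Decidable using (_×-dec_)
open import Relation.Unary using (Decidable)

open import Defs as Real hiding (_≈_; _+_; _*_; ∑)

-- Finite sums and indicators in a commutative semiring.

module SumsOver (R : CommutativeSemiring 0ℓ 0ℓ) where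
  open CommutativeSemiring R hiding (zero)
  open SemiringSum semiring using (sum; sum-cong-≋; ∑-comm; sum-replicate-zero;
    *-distribˡ-sum; *-distribʳ-sum)
  open Multiples +-monoid using () renaming (_×_ to _·_)
  open SetoidReasoning setoid

  sum-zero : ∀ {n} (t : Fin n → Carrier) → (∀ i → t i ≈ 0#) → sum t ≈ 0#
  sum-zero {n} t t≈0 = trans (sum-cong-≋ t≈0) (sum-replicate-zero n)

  sum-single : ∀ {n} (t : Fin n → Carrier) i → (∀ j → j ≢ i → t j ≈ 0#) → sum t ≈ t i
  sum-single t zero t≈0 =
    trans (+-congˡ (sum-zero (t ∘ suc) λ j → t≈0 (suc j) (0≢1+n ∘ ≡.sym)))
          (+-identityʳ (t zero))
  sum-single t (suc i) t≈0 =
    trans (+-cong (t≈0 zero 0≢1+n)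
                  (sum-single (t ∘ suc) i λ j j≢i → t≈0 (suc j) (j≢i ∘ suc-injective)))
          (+-identityˡ (t (suc i)))

  sum-++ : ∀ m {n} (t : Fin (m ℕ.+ n) → Carrier) →
           sum t ≈ sum (λ i → t (i ↑ˡ n)) + sum (λ j → t (m ↑ʳ j))
  sum-++ zero    t = sym (+-identityˡ _)
  sum-++ (suc m) t = trans (+-congˡ (sum-++ m (t ∘ suc))) (sym (+-assoc _ _ _))

  sum-combine : ∀ m {n} (t : Fin (m ℕ.* n) → Carrier) →
                sum t ≈ sum λ i → sum λ j → t (combine {m} {n} i j)
  sum-combine zero    t     = refl
  -- `Fin (suc m * n)` is `Fin (n + m * n)`; `combine` puts row `zero` in the first summand and
  -- shifts the other rows by `n`.
  sum-combine (suc m) {n} t = trans (sum-++ n t) (+-congˡ (sum-combine m (t ∘ (n ↑ʳ_))))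

  infix 8 ⟦_⟧
  -- Has the same body as `indicator`, so the two agree definitionally when `R` is the semiring of
  -- non-negative reals.
  ⟦_⟧ : {P : Set} → Dec P → Carrier
  ⟦ P? ⟧ = if does P? then 1# else 0#

  ⟦⟧-yes : {P : Set} (P? : Dec P) → P → ⟦ P? ⟧ ≈ 1#
  ⟦⟧-yes (yes _) _ = refl
  ⟦⟧-yes (no ¬p) p = contradiction p ¬p

  ⟦⟧-no : {P : Set} (P? : Dec P) → ¬ P → ⟦ P? ⟧ ≈ 0#
  ⟦⟧-no (yes p) ¬p = contradiction p ¬p
  ⟦⟧-no (no _)  _  = refl

  ⟦⟧-cong : {P Q : Set} (P? : Dec P) (Q? : Dec Q) → (P → Q) → (Q → P) → ⟦ P? ⟧ ≈ ⟦ Q? ⟧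
  ⟦⟧-cong P? (yes q) _   Q⇒P = ⟦⟧-yes P? (Q⇒P q)
  ⟦⟧-cong P? (no ¬q) P⇒Q _   = ⟦⟧-no P? (¬q ∘ P⇒Q)

  ⟦⟧-× : {P Q : Set} (P? : Dec P) (Q? : Dec Q) → ⟦ P? ×-dec Q? ⟧ ≈ ⟦ P? ⟧ * ⟦ Q? ⟧
  ⟦⟧-× (yes _) Q? = sym (*-identityˡ ⟦ Q? ⟧)
  ⟦⟧-× (no _)  Q? = sym (zeroˡ ⟦ Q? ⟧)

  count-tabulate : ∀ {A : Set} {P : A → Set} (P? : Decidable P) {n} (g : Fin n → A) →
                   count P? (tabulate g) · 1# ≈ sum λ i → ⟦ P? (g i) ⟧
  count-tabulate P? {zero}  g = refl
  count-tabulate P? {suc n} g with does (P? (g zero))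
  ... | true  = +-congˡ (count-tabulate P? (g ∘ suc))
  ... | false = trans (count-tabulate P? (g ∘ suc)) (sym (+-identityˡ _))

  ∑ : (X : FinSet) → (Elem X → Carrier) → Carrier
  ∑ X f = sum λ i → f (Inverse.to (enum X) i)

  ∑-cong : ∀ X {f g : Elem X → Carrier} → (∀ x → f x ≈ g x) → ∑ X f ≈ ∑ X g
  ∑-cong X f≈g = sum-cong-≋ λ i → f≈g (Inverse.to (enum X) i)

  ∑-swap : ∀ X Y (f : Elem X → Elem Y → Carrier) →
           (∑ X λ x → ∑ Y λ y → f x y) ≈ ∑ Y λ y → ∑ X λ x → f x y
  ∑-swap X Y f = ∑-comm λ i j → f (Inverse.to (enum X) i) (Inverse.to (enum Y) j)

  ∑-distribˡ : ∀ X c (f : Elem X → Carrier) → c * ∑ X f ≈ ∑ X λ x → c * f x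
  ∑-distribˡ X c f = *-distribˡ-sum c (f ∘ Inverse.to (enum X))

  ∑-distribʳ : ∀ X c (f : Elem X → Carrier) → ∑ X f * c ≈ ∑ X λ x → f x * c
  ∑-distribʳ X c f = *-distribʳ-sum c (f ∘ Inverse.to (enum X))

  ∑-⊗ : ∀ X Y (f : Elem X → Elem Y → Carrier) →
        ∑ (X ⊗ Y) (uncurry f) ≈ ∑ X λ x → ∑ Y λ y → f x y
  -- `enum (X ⊗ Y)` decodes an index by `remQuot`, which undoes the `combine` left by `sum-combine`.
  ∑-⊗ X Y f = trans (sum-combine (size X) _) (sum-cong-≋ λ i → sum-cong-≋ λ j →
    reflexive (≡.cong (λ p → f (Inverse.to (enum X) (proj₁ p)) (Inverse.to (enum Y) (proj₂ p)))
                      (remQuot-combine i j)))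

  δ : ∀ X → Elem X → Elem X → Carrier
  δ X x y = ⟦ _≟_ {X} x y ⟧

  ∑-δ : ∀ X x (f : Elem X → Carrier) → (∑ X λ y → δ X x y * f y) ≈ f x
  ∑-δ X x f = begin
    (∑ X λ y → δ X x y * f y)
      ≈⟨ sum-single _ (from x) (λ j j≢x → trans
           (*-congʳ (⟦⟧-no (_≟_ {X} x (to j)) λ x≡j → j≢x (≡.sym (inverseʳ x≡j))))
           (zeroˡ _)) ⟩
    δ X x (to (from x)) * f (to (from x))
      ≡⟨ ≡.cong (λ y → δ X x y * f y) (strictlyInverseˡ x) ⟩
    δ X x x * f x
      ≈⟨ *-congʳ (⟦⟧-yes (_≟_ {X} x x) ≡.refl) ⟩
    1# * f x
      ≈⟨ *-identityˡ _ ⟩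
    f x ∎
    where open Inverse (enum X)

  ∑-δʳ : ∀ X x (f : Elem X → Carrier) → (∑ X λ y → f y * δ X x y) ≈ f x
  ∑-δʳ X x f = trans (∑-cong X λ y → *-comm (f y) (δ X x y)) (∑-δ X x f)

  -- Associativity of matrix multiplication for a row `p`, a matrix `q` and a column `r`. All three
  -- monoid laws rest on it.
  ∑-assoc : ∀ X Y (p : Elem X → Carrier) (q : Elem X → Elem Y → Carrier) (r : Elem Y → Carrier) →
            (∑ X λ x → p x * ∑ Y λ y → q x y * r y) ≈ ∑ Y λ y → (∑ X λ x → p x * q x y) * r y
  ∑-assoc X Y p q r = begin
    (∑ X λ x → p x * ∑ Y λ y → q x y * r y)
      ≈⟨ ∑-cong X (λ x → trans (∑-distribˡ Y (p x) λ y → q x y * r y)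
                               (∑-cong Y λ y → sym (*-assoc (p x) (q x y) (r y)))) ⟩
    (∑ X λ x → ∑ Y λ y → p x * q x y * r y)
      ≈⟨ ∑-swap X Y (λ x y → p x * q x y * r y) ⟩
    (∑ Y λ y → ∑ X λ x → p x * q x y * r y)
      ≈⟨ ∑-cong Y (λ y → ∑-distribʳ X (r y) λ x → p x * q x y) ⟨
    (∑ Y λ y → (∑ X λ x → p x * q x y) * r y) ∎

  -- The variant of `∑-assoc` for an outer sum that runs over the right-hand factor of a product,
  -- where `r` stands on the left.
  ∑-exchange : ∀ X Y (p : Elem X → Carrier) (q : Elem X → Elem Y → Carrier) (r : Elem Y → Carrier) →
               (∑ X λ x → p x * ∑ Y λ y → r y * q x y) ≈ ∑ Y λ y → r y * ∑ X λ x → p x * q x y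
  ∑-exchange X Y p q r = begin
    (∑ X λ x → p x * ∑ Y λ y → r y * q x y)
      ≈⟨ ∑-cong X (λ x → *-congˡ {p x} (∑-cong Y λ y → *-comm (r y) (q x y))) ⟩
    (∑ X λ x → p x * ∑ Y λ y → q x y * r y)
      ≈⟨ ∑-assoc X Y p q r ⟩
    (∑ Y λ y → (∑ X λ x → p x * q x y) * r y)
      ≈⟨ ∑-cong Y (λ y → *-comm (∑ X λ x → p x * q x y) (r y)) ⟩
    (∑ Y λ y → r y * ∑ X λ x → p x * q x y) ∎

-- Matrices over a commutative semiring.

module MatricesOver (R : CommutativeSemiring 0ℓ 0ℓ) where
  open CommutativeSemiring R hiding (zero)
  open SumsOver R
  open SetoidReasoning setoid
  open CommutativeSemigroupProperties *-commutativeSemigroup using (x∙yz≈y∙xz)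

  -- The analogue of `Mat` for arbitrary coefficients, so that the algebra rests on the semiring
  -- laws alone and not on the construction of the reals.
  record Matrix (X Y : FinSet) : Set where
    constructor matrix
    field
      coeff : Elem X → Elem Y → Carrier

  open Matrix public

  private
    variable
      X Y Z W : FinSet

  infixr 9 _∙_
  _∙_ : Matrix Y Z → Matrix X Y → Matrix X Z
  _∙_ {Y = Y} g f = matrix λ a c → ∑ Y λ b → coeff f a b * coeff g b c

  infixr 10 _⊠_
  _⊠_ : Matrix X Y → Matrix Z W → Matrix (X ⊗ Z) (Y ⊗ W)
  f ⊠ g = matrix λ (a , c) (b , d) → coeff f a b * coeff g c d

  graph : (Elem X → Elem Y) → Matrix X Y
  graph {Y = Y} h = matrix λ x y → δ Y (h x) y

  identity : ∀ X → Matrix X X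
  identity X = graph id

  associator : ∀ X Y Z → Matrix ((X ⊗ Y) ⊗ Z) (X ⊗ (Y ⊗ Z))
  associator X Y Z = graph assocʳ

  infix 4 _≐_
  _≐_ : Matrix X Y → Matrix X Y → Set
  f ≐ g = ∀ x y → coeff f x y ≈ coeff g x y

  -- The Kronecker delta of `identity Z` collapses the `Z`-part of the sum over `Y ⊗ Z`.
  ∙-⊠identity : (f : Matrix X Y) (g : Matrix (Y ⊗ Z) W) → ∀ x z w →
                coeff (g ∙ (f ⊠ identity Z)) (x , z) w
                  ≈ ∑ Y λ y → coeff f x y * coeff g (y , z) w
  ∙-⊠identity {X} {Y} {Z} {W} (matrix f) (matrix g) x z w = begin
    (∑ (Y ⊗ Z) λ (y , z′) → f x y * δ Z z z′ * g (y , z′) w)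
      ≈⟨ ∑-⊗ Y Z (λ y z′ → f x y * δ Z z z′ * g (y , z′) w) ⟩
    (∑ Y λ y → ∑ Z λ z′ → f x y * δ Z z z′ * g (y , z′) w)
      ≈⟨ ∑-cong Y (λ y → ∑-cong Z λ z′ →
           trans (*-assoc _ _ _) (x∙yz≈y∙xz (f x y) (δ Z z z′) (g (y , z′) w))) ⟩
    (∑ Y λ y → ∑ Z λ z′ → δ Z z z′ * (f x y * g (y , z′) w))
      ≈⟨ ∑-cong Y (λ y → ∑-δ Z z (λ z′ → f x y * g (y , z′) w)) ⟩
    (∑ Y λ y → f x y * g (y , z) w) ∎

  ∙-identity⊠ : (f : Matrix Z Y) (g : Matrix (X ⊗ Y) W) → ∀ x z w →
                coeff (g ∙ (identity X ⊠ f)) (x , z) w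
                  ≈ ∑ Y λ y → coeff f z y * coeff g (x , y) w
  ∙-identity⊠ {Z} {Y} {X} {W} (matrix f) (matrix g) x z w = begin
    (∑ (X ⊗ Y) λ (x′ , y) → δ X x x′ * f z y * g (x′ , y) w)
      ≈⟨ ∑-⊗ X Y (λ x′ y → δ X x x′ * f z y * g (x′ , y) w) ⟩
    (∑ X λ x′ → ∑ Y λ y → δ X x x′ * f z y * g (x′ , y) w)
      ≈⟨ ∑-cong X (λ x′ → trans
           (∑-cong Y λ y → *-assoc (δ X x x′) (f z y) (g (x′ , y) w))
           (sym (∑-distribˡ Y (δ X x x′) λ y → f z y * g (x′ , y) w))) ⟩
    (∑ X λ x′ → δ X x x′ * ∑ Y λ y → f z y * g (x′ , y) w)
      ≈⟨ ∑-δ X x (λ x′ → ∑ Y λ y → f z y * g (x′ , y) w) ⟩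
    (∑ Y λ y → f z y * g (x , y) w) ∎

  -- Each row of `associator` is a Kronecker delta, so composing with it only rebrackets the index.
  ∙-identity⊠-associator : ∀ {V} (f : Matrix (Y ⊗ Z) W) (g : Matrix (X ⊗ W) V) → ∀ x y z v →
    coeff (g ∙ (identity X ⊠ f) ∙ associator X Y Z) ((x , y) , z) v
      ≈ ∑ W λ w → coeff f (y , z) w * coeff g (x , w) v
  ∙-identity⊠-associator {Y} {Z} {W} {X} f g x y z v = trans
    (∑-cong (X ⊗ W) λ p → *-congʳ {coeff g p v}
      (∑-δ (X ⊗ (Y ⊗ Z)) (x , (y , z)) λ q → coeff (identity X ⊠ f) q p))
    (∙-identity⊠ f g x (y , z) v)

-- The canonical action of a partition.

module ActionsOver (R : CommutativeSemiring 0ℓ 0ℓ) {X : FinSet} (S : Partition (X ⊗ X)) where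
  open CommutativeSemiring R hiding (zero)
  open SumsOver R
  open MatricesOver R
  open Multiples +-monoid using () renaming (_×_ to _·_)
  open SetoidReasoning setoid
  open Partition S renaming (Blocks to B)

  colour : Elem X → Elem X → Elem B
  colour x y = proj₁ (unique (x , y))

  colour-∈ : ∀ x y → block (colour x y) (x , y)
  colour-∈ x y = proj₁ (proj₂ (unique (x , y)))

  colour-unique : ∀ {x y a} → block a (x , y) → colour x y ≡ a
  colour-unique {x} {y} = proj₂ (proj₂ (unique (x , y)))

  γ : Matrix (X ⊗ B) X
  γ = matrix λ (x , a) y → ⟦ (x , y) ∈? a ⟧

  -- Each pair lies in exactly one block, so membership in `a` is equality of that block with `a`,
  -- and sums against `γ` become sums against a Kronecker delta.
  γ-δ : ∀ x a y → coeff γ (x , a) y ≈ δ B (colour x y) a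
  γ-δ x a y = ⟦⟧-cong ((x , y) ∈? a) (_≟_ {B} (colour x y) a) colour-unique
    λ { ≡.refl → colour-∈ x y }

  ∑-γ : ∀ (f : Elem B → Carrier) x y → (∑ B λ d → f d * coeff γ (x , d) y) ≈ f (colour x y)
  ∑-γ f x y = trans (∑-cong B λ d → *-congˡ {f d} (γ-δ x d y)) (∑-δʳ B (colour x y) f)

  -- A product of indicators is the indicator of the conjunction, so the sum over midpoints is a
  -- count; `_· 1#` carries it into the semiring.
  γ-intermediates : ∀ a b x y →
    (∑ X λ z → coeff γ (x , a) z * coeff γ (z , b) y) ≈ intermediates S a b x y · 1#
  γ-intermediates a b x y = trans
    (∑-cong X λ z → sym (⟦⟧-× ((x , z) ∈? a) ((z , y) ∈? b)))
    (sym (count-tabulate (λ z → ((x , z) ∈? a) ×-dec ((z , y) ∈? b)) (Inverse.to (enum X))))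

  -- The module axioms as conditions on coefficients.

  module _ (∇ : Matrix (B ⊗ B) B) where

    Associates : Set
    Associates = γ ∙ (γ ⊠ identity B) ≐ γ ∙ (identity X ⊠ ∇) ∙ associator X B B

    -- In the language of association schemes, the entries of `∇` are the intersection numbers.
    Counts : Set
    Counts = ∀ a b x y → intermediates S a b x y · 1# ≈ coeff ∇ (a , b) (colour x y)

    associates⇒counts : Associates → Counts
    associates⇒counts assoc a b x y = begin
      intermediates S a b x y · 1#
        ≈⟨ γ-intermediates a b x y ⟨
      (∑ X λ z → coeff γ (x , a) z * coeff γ (z , b) y)
        ≈⟨ ∙-⊠identity γ γ (x , a) b y ⟨
      coeff (γ ∙ (γ ⊠ identity B)) ((x , a) , b) y
        ≈⟨ assoc ((x , a) , b) y ⟩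
      coeff (γ ∙ (identity X ⊠ ∇) ∙ associator X B B) ((x , a) , b) y
        ≈⟨ ∙-identity⊠-associator ∇ γ x a b y ⟩
      (∑ B λ d → coeff ∇ (a , b) d * coeff γ (x , d) y)
        ≈⟨ ∑-γ (coeff ∇ (a , b)) x y ⟩
      coeff ∇ (a , b) (colour x y) ∎

    counts⇒associates : Counts → Associates
    counts⇒associates counts ((x , a) , b) y = begin
      coeff (γ ∙ (γ ⊠ identity B)) ((x , a) , b) y
        ≈⟨ ∙-⊠identity γ γ (x , a) b y ⟩
      (∑ X λ z → coeff γ (x , a) z * coeff γ (z , b) y)
        ≈⟨ γ-intermediates a b x y ⟩
      intermediates S a b x y · 1#
        ≈⟨ counts a b x y ⟩
      coeff ∇ (a , b) (colour x y)
        ≈⟨ ∑-γ (coeff ∇ (a , b)) x y ⟨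
      (∑ B λ d → coeff ∇ (a , b) d * coeff γ (x , d) y)
        ≈⟨ ∙-identity⊠-associator ∇ γ x a b y ⟨
      coeff (γ ∙ (identity X ⊠ ∇) ∙ associator X B B) ((x , a) , b) y ∎

  module _ (e : Matrix I B) where

    Unital : Set
    Unital = γ ∙ (identity X ⊠ e) ≐ graph proj₁

    MarksDiagonal : Set
    MarksDiagonal = ∀ x y → coeff e tt (colour x y) ≈ δ X x y

    γ-unit : ∀ x y → coeff (γ ∙ (identity X ⊠ e)) (x , tt) y ≈ coeff e tt (colour x y)
    γ-unit x y = trans (∙-identity⊠ e γ x tt y) (∑-γ (coeff e tt) x y)

    unital⇒marksDiagonal : Unital → MarksDiagonal
    unital⇒marksDiagonal unit x y = trans (sym (γ-unit x y)) (unit (x , tt) y)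

    marksDiagonal⇒unital : MarksDiagonal → Unital
    marksDiagonal⇒unital diag (x , tt) y = trans (γ-unit x y) (diag x y)

  -- Faithfulness of γ.
  by-representatives : ∀ {f g : Elem B → Carrier} →
                       (∀ x y → f (colour x y) ≈ g (colour x y)) → ∀ d → f d ≈ g d
  by-representatives {f} {g} h d with nonempty d
  ... | (x , y) , xy∈d = ≡.subst (λ c → f c ≈ g c) (colour-unique xy∈d) (h x y)

  -- The monoid laws, through the adjacency matrices of the blocks.

  module _ (∇ : Matrix (B ⊗ B) B) (e : Matrix I B) (counts : Counts ∇) (diag : MarksDiagonal e) where

    -- Write A_a for the 0/1 matrix with entries `coeff γ (x , a) y`. The right-hand side is the (x,
    -- y) entry of A_a A_b, so laws for `∇` become laws for products of these matrices.
    ∇-colour : ∀ a b x y →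
      coeff ∇ (a , b) (colour x y) ≈ ∑ X λ z → coeff γ (x , a) z * coeff γ (z , b) y
    ∇-colour a b x y = trans (sym (counts a b x y)) (sym (γ-intermediates a b x y))

    ∑-e : ∀ x y → (∑ B λ d → coeff e tt d * coeff γ (x , d) y) ≈ δ X x y
    ∑-e x y = trans (∑-γ (coeff e tt) x y) (diag x y)

    -- The sum of ∇_{ab}^d A_d over d is A_a A_b: `γ` turns `∇` into matrix multiplication.
    ∑-∇ : ∀ a b x y → (∑ B λ d → coeff ∇ (a , b) d * coeff γ (x , d) y)
                        ≈ ∑ X λ z → coeff γ (x , a) z * coeff γ (z , b) y
    ∑-∇ a b x y = trans (∑-γ (coeff ∇ (a , b)) x y) (∇-colour a b x y)

    -- The orientation found in `graph`, whose delta takes the source index first.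
    γ-δʳ : ∀ b x y → coeff γ (x , b) y ≈ δ B b (colour x y)
    γ-δʳ b x y = trans (γ-δ x b y)
      (⟦⟧-cong (_≟_ {B} (colour x y) b) (_≟_ {B} b (colour x y)) ≡.sym ≡.sym)

    -- At `colour x y` the left side is the (x, y) entry of (Σ e_a A_a) A_b, and Σ e_a A_a is the
    -- identity matrix by `∑-e`.
    identityˡ : ∇ ∙ (e ⊠ identity B) ≐ graph proj₂
    identityˡ (tt , b) = by-representatives λ x y → begin
      coeff (∇ ∙ (e ⊠ identity B)) (tt , b) (colour x y)
        ≈⟨ ∙-⊠identity e ∇ tt b (colour x y) ⟩
      (∑ B λ a → coeff e tt a * coeff ∇ (a , b) (colour x y))
        ≈⟨ ∑-cong B (λ a → *-congˡ {coeff e tt a} (∇-colour a b x y)) ⟩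
      (∑ B λ a → coeff e tt a * ∑ X λ z → coeff γ (x , a) z * coeff γ (z , b) y)
        ≈⟨ ∑-assoc B X (coeff e tt) (λ a z → coeff γ (x , a) z) (λ z → coeff γ (z , b) y) ⟩
      (∑ X λ z → (∑ B λ a → coeff e tt a * coeff γ (x , a) z) * coeff γ (z , b) y)
        ≈⟨ ∑-cong X (λ z → *-congʳ {coeff γ (z , b) y} (∑-e x z)) ⟩
      (∑ X λ z → δ X x z * coeff γ (z , b) y)
        ≈⟨ ∑-δ X x (λ z → coeff γ (z , b) y) ⟩
      coeff γ (x , b) y
        ≈⟨ γ-δʳ b x y ⟩
      δ B b (colour x y) ∎

    -- As for `identityˡ`, now with A_a (Σ e_b A_b).
    identityʳ : ∇ ∙ (identity B ⊠ e) ≐ graph proj₁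
    identityʳ (a , tt) = by-representatives λ x y → begin
      coeff (∇ ∙ (identity B ⊠ e)) (a , tt) (colour x y)
        ≈⟨ ∙-identity⊠ e ∇ a tt (colour x y) ⟩
      (∑ B λ b → coeff e tt b * coeff ∇ (a , b) (colour x y))
        ≈⟨ ∑-cong B (λ b → *-congˡ {coeff e tt b} (∇-colour a b x y)) ⟩
      (∑ B λ b → coeff e tt b * ∑ X λ z → coeff γ (x , a) z * coeff γ (z , b) y)
        ≈⟨ ∑-exchange B X (coeff e tt) (λ b z → coeff γ (z , b) y) (coeff γ (x , a)) ⟩
      (∑ X λ z → coeff γ (x , a) z * ∑ B λ b → coeff e tt b * coeff γ (z , b) y)
        -- `∑-e` yields `δ X z y`, while `∑-δʳ` wants the fixed index `y` first.
        ≈⟨ ∑-cong X (λ z → *-congˡ {coeff γ (x , a) z} (trans (∑-e z y)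
             (⟦⟧-cong (_≟_ {X} z y) (_≟_ {X} y z) ≡.sym ≡.sym))) ⟩
      (∑ X λ z → coeff γ (x , a) z * δ X y z)
        ≈⟨ ∑-δʳ X y (coeff γ (x , a)) ⟩
      coeff γ (x , a) y
        ≈⟨ γ-δʳ a x y ⟩
      δ B a (colour x y) ∎

    -- At `colour x y` the two sides are the (x, y) entries of (A_a A_b) A_c and A_a (A_b A_c).
    associativity : ∇ ∙ (∇ ⊠ identity B) ≐ ∇ ∙ (identity B ⊠ ∇) ∙ associator B B B
    associativity ((a , b) , c) = by-representatives λ x y → begin
      coeff (∇ ∙ (∇ ⊠ identity B)) ((a , b) , c) (colour x y)
        ≈⟨ ∙-⊠identity ∇ ∇ (a , b) c (colour x y) ⟩
      (∑ B λ d → coeff ∇ (a , b) d * coeff ∇ (d , c) (colour x y))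
        ≈⟨ ∑-cong B (λ d → *-congˡ {coeff ∇ (a , b) d} (∇-colour d c x y)) ⟩
      (∑ B λ d → coeff ∇ (a , b) d * ∑ X λ z → coeff γ (x , d) z * coeff γ (z , c) y)
        ≈⟨ ∑-assoc B X (coeff ∇ (a , b)) (λ d z → coeff γ (x , d) z) (λ z → coeff γ (z , c) y) ⟩
      (∑ X λ z → (∑ B λ d → coeff ∇ (a , b) d * coeff γ (x , d) z) * coeff γ (z , c) y)
        ≈⟨ ∑-cong X (λ z → *-congʳ {coeff γ (z , c) y} (∑-∇ a b x z)) ⟩
      (∑ X λ z → (∑ X λ w → coeff γ (x , a) w * coeff γ (w , b) z) * coeff γ (z , c) y)
        ≈⟨ ∑-assoc X X (coeff γ (x , a)) (λ w z → coeff γ (w , b) z) (λ z → coeff γ (z , c) y) ⟨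
      (∑ X λ w → coeff γ (x , a) w * ∑ X λ z → coeff γ (w , b) z * coeff γ (z , c) y)
        ≈⟨ ∑-cong X (λ w → *-congˡ {coeff γ (x , a) w} (∑-∇ b c w y)) ⟨
      (∑ X λ w → coeff γ (x , a) w * ∑ B λ d → coeff ∇ (b , c) d * coeff γ (w , d) y)
        ≈⟨ ∑-exchange B X (coeff ∇ (b , c)) (λ d w → coeff γ (w , d) y) (coeff γ (x , a)) ⟨
      (∑ B λ d → coeff ∇ (b , c) d * ∑ X λ w → coeff γ (x , a) w * coeff γ (w , d) y)
        ≈⟨ ∑-cong B (λ d → *-congˡ {coeff ∇ (b , c) d} (∇-colour a d x y)) ⟨
      (∑ B λ d → coeff ∇ (b , c) d * coeff ∇ (a , d) (colour x y))
        ≈⟨ ∙-identity⊠-associator ∇ ∇ a b c (colour x y) ⟨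
      coeff (∇ ∙ (identity B ⊠ ∇) ∙ associator B B B) ((a , b) , c) (colour x y) ∎

  -- CC2 and CC3 against the coefficient conditions.

  counts⇒CC3 : (∀ m n → m · 1# ≈ n · 1# → m ≡ n) → ∀ ∇ → Counts ∇ → CC3 S
  counts⇒CC3 injective ∇ counts a b c {x} {y} {x′} {y′} xy∈c xy′∈c = injective _ _ (begin
    intermediates S a b x y · 1#    ≈⟨ counts a b x y ⟩
    -- Both pairs lie in `c`, so both have colour `c` and select the same entry of `∇`.
    coeff ∇ (a , b) (colour x y)    ≡⟨ ≡.cong (coeff ∇ (a , b))
                                         (≡.trans (colour-unique xy∈c) (≡.sym (colour-unique xy′∈c))) ⟩
    coeff ∇ (a , b) (colour x′ y′)  ≈⟨ counts a b x′ y′ ⟨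
    intermediates S a b x′ y′ · 1#  ∎)

  -- A diagonal and an off-diagonal pair in `p` would force the entry of `e` at `p` to be both 1 and
  -- 0.
  marksDiagonal⇒CC2 : ¬ 1# ≈ 0# → ∀ e → MarksDiagonal e → CC2 S
  marksDiagonal⇒CC2 1≉0 e diag p (x , xx∈p) {z , w} zw∈p with _≟_ {X} z w
  ... | yes z≡w = z≡w
  ... | no  z≢w = contradiction (begin
    1#                       ≈⟨ ⟦⟧-yes (_≟_ {X} x x) ≡.refl ⟨
    δ X x x                  ≈⟨ diag x x ⟨
    coeff e tt (colour x x)  ≡⟨ ≡.cong (coeff e tt)
                                  (≡.trans (colour-unique xx∈p) (≡.sym (colour-unique zw∈p))) ⟩
    coeff e tt (colour z w)  ≈⟨ diag z w ⟩
    δ X z w                  ≈⟨ ⟦⟧-no (_≟_ {X} z w) z≢w ⟩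
    0#                       ∎) 1≉0

  -- An arbitrary choice of pair in each block. `CC3` and `CC2` make the two matrices below
  -- independent of it.
  representative : Elem B → Elem X × Elem X
  representative d = proj₁ (nonempty d)

  structureConstants : Matrix (B ⊗ B) B
  structureConstants = matrix λ (a , b) d → uncurry (intermediates S a b) (representative d) · 1#

  diagonalIndicator : Matrix I B
  diagonalIndicator = matrix λ _ d → uncurry (δ X) (representative d)

  CC3⇒counts : CC3 S → Counts structureConstants
  CC3⇒counts cc3 a b x y = reflexive (≡.cong (_· 1#)
    (cc3 a b (colour x y) (colour-∈ x y) (proj₂ (nonempty (colour x y)))))

  -- `(x , y)` and the representative of its block share that block, so by `CC2` one is diagonal
  -- exactly when the other is.
  CC2⇒marksDiagonal : CC2 S → MarksDiagonal diagonalIndicator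
  CC2⇒marksDiagonal cc2 x y with nonempty (colour x y)
  ... | (x′ , y′) , ∈colour = ⟦⟧-cong (_≟_ {X} x′ y′) (_≟_ {X} x y)
    (λ { ≡.refl → cc2 (colour x y) (x′ , ∈colour) (colour-∈ x y) })
    (λ { ≡.refl → cc2 (colour x y) (x , colour-∈ x y) ∈colour })

-- Arithmetic of the non-negative Cauchy reals.

close-pointwise : ∀ {x y} → (∀ n → seq x n ≡ seq y n) → x ≃ y
close-pointwise {x} {y} x≡y = mk≃ λ ε 0<ε → 0 , λ n _ →
  ≡.subst (ℚ._< ε)
    (≡.sym (≡.cong ∣_∣ (≡.trans (≡.cong (ℚ._- seq y n) (x≡y n)) (ℚ.+-inverseʳ (seq y n))))) 0<ε

≃-sym : ∀ {x y} → x ≃ y → y ≃ x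
≃-sym {x} {y} x≃y = mk≃ λ ε 0<ε → let N , h = close x≃y ε 0<ε in N , λ n N≤n →
  ≡.subst (ℚ._< ε)
    (≡.trans (≡.sym (ℚ.∣-p∣≡∣p∣ (seq x n ℚ.- seq y n))) (≡.cong ∣_∣ (neg-sub (seq x n) (seq y n))))
    (h n N≤n)
  where
  open +-*-Solver
  neg-sub : ∀ p q → ℚ.- (p ℚ.- q) ≡ q ℚ.- p
  neg-sub = solve 2 (λ p q → :- (p :- q) := q :- p) ≡.refl

≃-trans : ∀ {x y z} → x ≃ y → y ≃ z → x ≃ z
≃-trans {x} {y} {z} x≃y y≃z = mk≃ λ ε 0<ε → both
  (λ n p q → ℚ.≤-<-trans
    (triangle (seq x n ℚ.- seq y n) (seq y n ℚ.- seq z n) (telescope (seq x n) (seq y n) (seq z n)))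
    (half+half< p q))
  (close x≃y (½ ℚ.* ε) (half>0 0<ε)) (close y≃z (½ ℚ.* ε) (half>0 0<ε))
  where
  open +-*-Solver
  telescope : ∀ p q r → (p ℚ.- q) ℚ.+ (q ℚ.- r) ≡ p ℚ.- r
  telescope = solve 3 (λ p q r → (p :- q) :+ (q :- r) := p :- r) ≡.refl

+ᴿ-cong : ∀ {x x′ y y′} → x ≃ x′ → y ≃ y′ → x +ᴿ y ≃ x′ +ᴿ y′
+ᴿ-cong {x} {x′} {y} {y′} x≃x′ y≃y′ = mk≃ λ ε 0<ε → both
  (λ n p q → ℚ.≤-<-trans
    (triangle (seq x n ℚ.- seq x′ n) (seq y n ℚ.- seq y′ n)
      (regroup (seq x n) (seq x′ n) (seq y n) (seq y′ n)))
    (half+half< p q))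
  (close x≃x′ (½ ℚ.* ε) (half>0 0<ε)) (close y≃y′ (½ ℚ.* ε) (half>0 0<ε))
  where
  open +-*-Solver
  regroup : ∀ p p′ q q′ → (p ℚ.- p′) ℚ.+ (q ℚ.- q′) ≡ (p ℚ.+ q) ℚ.- (p′ ℚ.+ q′)
  regroup = solve 4 (λ p p′ q q′ → (p :- p′) :+ (q :- q′) := (p :+ q) :- (p′ :+ q′)) ≡.refl

*ᴿ-cong : ∀ {x x′ y y′} → x ≃ x′ → y ≃ y′ → x *ᴿ y ≃ x′ *ᴿ y′
*ᴿ-cong {x} {x′} {y} {y′} x≃x′ y≃y′ = mk≃ λ ε 0<ε →
  -- The difference splits as x(y - y′) + y′(x - x′), so the factors to bound are `x` and `y′`; `δ`
  -- is ε/2K and `η` is ε/2L.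
  let K , 0<K , x<K  = bounded (seq x) (cauchy x)
      L , 0<L , y′<L = bounded (seq y′) (cauchy y′)
      δ , 0<δ , Kδ   = quotient K 0<K (½ ℚ.* ε) (half>0 0<ε)
      η , 0<η , Lη   = quotient L 0<L (½ ℚ.* ε) (half>0 0<ε)
  in both
       (λ n (x< , y<) (y′< , x-x′<) →
         products-close ε K δ L η (seq x n) (seq y n) (seq x′ n) (seq y′ n)
           0<K 0<L Kδ Lη x< y< y′< x-x′<)
       (both (λ _ → _,_) x<K (close y≃y′ δ 0<δ))
       (both (λ _ → _,_) y′<L (close x≃x′ η 0<η))

1+ᴿ-cancel : ∀ {x y} → 1ᴿ +ᴿ x ≃ 1ᴿ +ᴿ y → x ≃ y
1+ᴿ-cancel {x} {y} 1+x≃1+y = mk≃ λ ε 0<ε → let N , h = close 1+x≃1+y ε 0<ε in N , λ n N≤n →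
  ≡.subst (ℚ._< ε) (≡.cong ∣_∣ (cancel 1ℚ (seq x n) (seq y n))) (h n N≤n)
  where
  open +-*-Solver
  cancel : ∀ r p q → (r ℚ.+ p) ℚ.- (r ℚ.+ q) ≡ p ℚ.- q
  cancel = solve 3 (λ r p q → (r :+ p) :- (r :+ q) := p :- q) ≡.refl

-- With both tolerances equal to ½, eventually x > -½ and hence 1 + x > ½, while closeness to zero
-- gives ∣1 + x∣ < ½.
1+nonneg≄0 : ∀ {x} → 0ᴿ ≤ x → ¬ 1ᴿ +ᴿ x ≃ 0ᴿ
1+nonneg≄0 {x} 0≤x 1+x≃0 =
  let N , h = both (λ _ → _,_) (close 1+x≃0 ½ 0<½) (almost 0≤x ½ 0<½)
      ∣1+x∣<½ , 0<x+½ = h N ℕ.≤-refl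
  in ℚ.<-irrefl ≡.refl (begin-strict
    ½                              ≡⟨ ℚ.+-identityʳ ½ ⟨
    ½ ℚ.+ 0ℚ                       <⟨ ℚ.+-monoʳ-< ½ 0<x+½ ⟩
    -- `½ + ½` evaluates to `1ℚ`; the trailing `- 0ℚ` matches the form of closeness to `0ᴿ`.
    ½ ℚ.+ (seq x N ℚ.+ ½)          ≡⟨ regroup ½ (seq x N) ⟩
    (1ℚ ℚ.+ seq x N) ℚ.- 0ℚ        ≤⟨ p≤∣p∣ ((1ℚ ℚ.+ seq x N) ℚ.- 0ℚ) ⟩
    ∣ (1ℚ ℚ.+ seq x N) ℚ.- 0ℚ ∣    <⟨ ∣1+x∣<½ ⟩
    ½                              ∎)
  where
  open ℚ.≤-Reasoning
  open +-*-Solver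
  0<½ : 0ℚ ℚ.< ½
  0<½ = ℚ.positive⁻¹ ½
  regroup : ∀ h p → h ℚ.+ (p ℚ.+ h) ≡ ((h ℚ.+ h) ℚ.+ p) ℚ.- 0ℚ
  regroup = solve 2 (λ h p → h :+ (p :+ h) := ((h :+ h) :+ p) :- con 0ℚ) ≡.refl
  p≤∣p∣ : ∀ p → p ℚ.≤ ∣ p ∣
  p≤∣p∣ p with ℚ.≤-total 0ℚ p
  ... | inj₁ 0≤p = ℚ.≤-reflexive (≡.sym (ℚ.0≤p⇒∣p∣≡p 0≤p))
  ... | inj₂ p≤0 = ℚ.≤-trans p≤0 (ℚ.0≤∣p∣ p)

-- The algebraic laws hold in ℚ at every index, so each follows from `close-pointwise` without
-- estimates.
ℝ≥0-commutativeSemiring : CommutativeSemiring 0ℓ 0ℓ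
ℝ≥0-commutativeSemiring = record
  { Carrier               = ℝ≥0
  ; _≈_                   = Real._≈_
  ; _+_                   = Real._+_
  ; _*_                   = Real._*_
  ; 0#                    = 𝟘
  ; 1#                    = 𝟙
  ; isCommutativeSemiring = isCommutativeSemiringˡ record
    { +-isCommutativeMonoid = record
      { isMonoid = record
        { isSemigroup = record
          { isMagma = record { isEquivalence = isEquivalence ; ∙-cong = +ᴿ-cong }
          ; assoc   = λ x y z → close-pointwise λ n → ℚ.+-assoc (at x n) (at y n) (at z n)
          }
        ; identity = (λ x → close-pointwise λ n → ℚ.+-identityˡ (at x n))
                   , (λ x → close-pointwise λ n → ℚ.+-identityʳ (at x n))
        }
      ; comm = λ x y → close-pointwise λ n → ℚ.+-comm (at x n) (at y n)
      }
    ; *-isCommutativeMonoid = record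
      { isMonoid = record
        { isSemigroup = record
          { isMagma = record { isEquivalence = isEquivalence ; ∙-cong = *ᴿ-cong }
          ; assoc   = λ x y z → close-pointwise λ n → ℚ.*-assoc (at x n) (at y n) (at z n)
          }
        ; identity = (λ x → close-pointwise λ n → ℚ.*-identityˡ (at x n))
                   , (λ x → close-pointwise λ n → ℚ.*-identityʳ (at x n))
        }
      ; comm = λ x y → close-pointwise λ n → ℚ.*-comm (at x n) (at y n)
      }
    ; distribʳ = λ z x y → close-pointwise λ n → ℚ.*-distribʳ-+ (at z n) (at x n) (at y n)
    ; zeroˡ    = λ x → close-pointwise λ n → ℚ.*-zeroˡ (at x n)
    }
  }
  where
  at : ℝ≥0 → ℕ → ℚ
  at x = seq (value x)
  isEquivalence : IsEquivalence Real._≈_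
  isEquivalence = record
    { refl  = close-pointwise λ _ → ≡.refl
    ; sym   = ≃-sym
    ; trans = ≃-trans
    }

-- The natural numbers inside the non-negative reals.

open Multiples (CommutativeSemiring.+-monoid ℝ≥0-commutativeSemiring) using ()
  renaming (_×_ to _·_)

-- Cancel one unit at a time. The mixed cases are impossible because a multiple of `𝟙` is
-- non-negative, so one more than it cannot be zero.
·𝟙-injective : ∀ m n → (m · 𝟙) Real.≈ (n · 𝟙) → m ≡ n
·𝟙-injective zero    zero    _     = ≡.refl
·𝟙-injective zero    (suc n) 0≈1+n =
  contradiction (≃-sym {0ᴿ} {1ᴿ +ᴿ value (n · 𝟙)} 0≈1+n) (1+nonneg≄0 {value (n · 𝟙)} (nonneg (n · 𝟙)))
·𝟙-injective (suc m) zero    1+m≈0 =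
  contradiction 1+m≈0 (1+nonneg≄0 {value (m · 𝟙)} (nonneg (m · 𝟙)))
·𝟙-injective (suc m) (suc n) m≈n   =
  ≡.cong suc (·𝟙-injective m n (1+ᴿ-cancel {value (m · 𝟙)} {value (n · 𝟙)} m≈n))

𝟙≉𝟘 : ¬ 𝟙 Real.≈ 𝟘
-- `1 · 𝟙` unfolds to `𝟙 + 𝟘`, hence the detour through `+-identityʳ`.
𝟙≉𝟘 1≈0 = ℕ.1+n≢0 (·𝟙-injective 1 0 (≃-trans {value (1 · 𝟙)} {1ᴿ} {0ᴿ} (+-identityʳ 𝟙) 1≈0))
  where open CommutativeSemiring ℝ≥0-commutativeSemiring

-- Specialisation to matrices of non-negative reals.

theorem3p1 : (X : FinSet) (S : Partition (X ⊗ X)) →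
    ((∃ λ (M : PointedMagma (Partition.Blocks S)) → IsModule M (canonicalAction S)) ⇔
    (CC2 S × CC3 S))
    × (∀ (M : PointedMagma (Partition.Blocks S)) → IsModule M (canonicalAction S) → IsMonoid M)
theorem3p1 X S = mk⇔ necessary sufficient , monoid
  where
  open MatricesOver ℝ≥0-commutativeSemiring using (Matrix; matrix; coeff)
  open ActionsOver ℝ≥0-commutativeSemiring S

  -- Changes the record only: over this semiring `_∙_`, `_⊠_` and `graph` have by definition the
  -- same entries as `_∘ₘ_`, `_⊗ₘ_` and `fromMap`, so module and monoid laws pass across without
  -- conversion.
  matrixOf : ∀ {Y Z} → Mat Y Z → Matrix Y Z
  matrixOf f = matrix (entry f)

  module _ (M : PointedMagma (Partition.Blocks S)) (module′ : IsModule M (canonicalAction S)) where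
    open PointedMagma M

    counts : Counts (matrixOf ∇)
    counts = associates⇒counts (matrixOf ∇) (IsModule.action module′)

    diagonal : MarksDiagonal (matrixOf e)
    diagonal = unital⇒marksDiagonal (matrixOf e) (IsModule.unit module′)

    monoid : IsMonoid M
    monoid = record
      { identityˡ = identityˡ (matrixOf ∇) (matrixOf e) counts diagonal
      ; identityʳ = identityʳ (matrixOf ∇) (matrixOf e) counts diagonal
      ; assoc     = associativity (matrixOf ∇) (matrixOf e) counts diagonal
      }

  necessary : (∃ λ M → IsModule M (canonicalAction S)) → CC2 S × CC3 S
  necessary (M , module′) =
      marksDiagonal⇒CC2 𝟙≉𝟘 (matrixOf (PointedMagma.e M)) (diagonal M module′)
    , counts⇒CC3 ·𝟙-injective (matrixOf (PointedMagma.∇ M)) (counts M module′)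

  sufficient : CC2 S × CC3 S → ∃ λ M → IsModule M (canonicalAction S)
  sufficient (cc2 , cc3) =
      record { ∇ = mat (coeff structureConstants) ; e = mat (coeff diagonalIndicator) }
    , record
      { action = counts⇒associates structureConstants (CC3⇒counts cc3)
      ; unit   = marksDiagonal⇒unital diagonalIndicator (CC2⇒marksDiagonal cc2)
      }
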